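{- Let $C$ be an ordered field. The theory $T_{\mathrm{Ham}}$ is not strongly dependent. Therefore it is not dp-minimal and does not have finite dp-rank.
   Context: A $2$-ordered $C$-vector space is a $C$-vector space $G$ with two linear orders $<_0,<_1$, each making $G$ an ordered $C$-vector space (ordered abelian group with $\lambda>0,x>0\Rightarrow\lambda x>0$ for $\lambda\in C$). Put $G_\infty=G\cup\{\infty\}$ with $\infty$ above $G$ in both orders. A Hamel valuation on $G$ is a map $v:G\to G_\infty$ such that for all $x,y\in G$, $\lambda\in C\setminus\{0\}$: $v(x)=\infty$ iff $x=0$; $v(x+y)\geq_0\min_0(v(x),v(y))$; $v(\lambda x)=v(x)$; if $0<_1x<_1y$ then $v(x)\geq_0v(y)$; $v(v(x))=v(x)$ (with $v(\infty)=\infty$); and $v(x)>_10$. A Hamel space $(G,v)$ is independent if for all $a_0<_0b_0$, $a_1<_1b_1$ in $G\cup\{\pm\infty\}$ there is $z\in G$ with $a_0<_0z<_0b_0$ and $a_1<_1z<_1b_1$; dense if for all $a<_0b$ in $G$ there is $c\in G$ with $a<_0v(c)<_0b$. $T_{\mathrm{Ham}}$ is the complete theory, in the language $\{0,+,(\lambda_c)_{c\in C},<_0,<_1,v,\infty\}$ (structures on $G_\infty$ with $\infty$ as default value for $+,\lambda_c,v$), whose models are exactly the independent dense Hamel spaces over $C$. Strongly dependent, dp-minimal and finite dp-rank are Shelah's standard notions: $T$ is strongly dependent if there is no sequence of formulas $\varphi_n(x;y_n)$ ($n<\omega$, $x$ a fixed finite tuple of variables) with parameters $(b_{n,k})_{n,k<\omega}$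 in a model such that for every $\eta:\omega\to\omega$ the set $\{\varphi_n(x;b_{n,\eta(n)}):n<\omega\}\cup\{\neg\varphi_n(x;b_{n,k}):n<\omega,k\neq\eta(n)\}$ is consistent. -}

module Defs where

open import Level using (0ℓ)
open import Data.Nat as ℕ using (ℕ; suc)
open import Data.Fin as Fin using (Fin)
open import Data.Sum using (_⊎_)
open import Data.Vec.Functional using (Vector; _++_)
open import Data.Maybe using (Maybe; just; nothing)
open import Data.Product using (Σ; ∃; _×_; _,_)
open import Data.Unit using (⊤)
open import Data.Empty using (⊥)
open import Relation.Nullary using (¬_)
open import Relation.Binary.PropositionalEquality using (_≡_; _≢_)
open import Relation.Binary.Structures using (IsStrictTotalOrder)
open import Algebra.Structures using (IsCommutativeRing; IsAbelianGroup)

record OrderedField : Set₁ where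
  field
    Carrier : Set
    _+_ _*_ : Carrier → Carrier → Carrier
    -_      : Carrier → Carrier
    0# 1#   : Carrier
    _<_     : Carrier → Carrier → Set
    isCommutativeRing : IsCommutativeRing _≡_ _+_ _*_ -_ 0# 1#
    0≢1     : 0# ≢ 1#
    inverse : ∀ x → x ≢ 0# → ∃ λ y → x * y ≡ 1#
    isStrictTotalOrder : IsStrictTotalOrder _≡_ _<_
    +-mono  : ∀ {x y} z → x < y → (x + z) < (y + z)
    *-pos   : ∀ {x y} → 0# < x → 0# < y → 0# < (x * y)

-- Extended set G∞ = G ∪ {∞}, with ∞ = nothing

module _ {G : Set} where

  Lt∞ : (G → G → Set) → Maybe G → Maybe G → Set
  Lt∞ R (just a) (just b) = R a b
  Lt∞ R (just a) nothing  = ⊤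
  Lt∞ R nothing  _        = ⊥

  Le∞ : (G → G → Set) → Maybe G → Maybe G → Set
  Le∞ R x y = Lt∞ R x y ⊎ x ≡ y

  -- "lo < z" where lo ∈ G ∪ {-∞}, nothing = -∞
  AboveLo : (G → G → Set) → Maybe G → G → Set
  AboveLo R (just a) z = R a z
  AboveLo R nothing  z = ⊤

  -- "z < hi" where hi ∈ G ∪ {+∞}, nothing = +∞
  BelowHi : (G → G → Set) → G → Maybe G → Set
  BelowHi R z (just b) = R z b
  BelowHi R z nothing  = ⊤

  -- "lo < hi" for lo ∈ G ∪ {-∞}, hi ∈ G ∪ {+∞}
  LoHi : (G → G → Set) → Maybe G → Maybe G → Set
  LoHi R (just a) (just b) = R a b
  LoHi R _        _        = ⊤

-- Independent dense Hamel spaces over C (= the models of T_Ham)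

record HamelSpace (C : OrderedField) : Set₁ where
  module C = OrderedField C
  field
    Carrier : Set
    _+_  : Carrier → Carrier → Carrier
    -_   : Carrier → Carrier
    0#   : Carrier
    _·_  : C.Carrier → Carrier → Carrier
    _<₀_ _<₁_ : Carrier → Carrier → Set
    v    : Carrier → Maybe Carrier
    isAbelianGroup : IsAbelianGroup _≡_ _+_ 0# -_
    ·-assoc  : ∀ a b x → (a C.* b) · x ≡ a · (b · x)
    ·-unit   : ∀ x → C.1# · x ≡ x
    ·-distˡ  : ∀ a x y → a · (x + y) ≡ (a · x) + (a · y)
    ·-distʳ  : ∀ a b x → (a C.+ b) · x ≡ (a · x) + (b · x)
    <₀-sto   : IsStrictTotalOrder _≡_ _<₀_
    <₁-sto   : IsStrictTotalOrder _≡_ _<₁_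
    <₀-+     : ∀ {x y} z → x <₀ y → (x + z) <₀ (y + z)
    <₁-+     : ∀ {x y} z → x <₁ y → (x + z) <₁ (y + z)
    <₀-·     : ∀ {a x} → C.0# C.< a → 0# <₀ x → 0# <₀ (a · x)
    <₁-·     : ∀ {a x} → C.0# C.< a → 0# <₁ x → 0# <₁ (a · x)
    v-∞      : ∀ x → (v x ≡ nothing → x ≡ 0#) × (x ≡ 0# → v x ≡ nothing)
    v-ultra  : ∀ x y → Le∞ _<₀_ (v x) (v (x + y)) ⊎ Le∞ _<₀_ (v y) (v (x + y))
    v-scal   : ∀ a x → a ≢ C.0# → v (a · x) ≡ v x
    v-anti   : ∀ x y → 0# <₁ x → x <₁ y → Le∞ _<₀_ (v y) (v x)
    v-idem   : ∀ x g → v x ≡ just g → v g ≡ just g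
    v-pos    : ∀ x → Lt∞ _<₁_ (just 0#) (v x)
    independent : ∀ a₀ b₀ a₁ b₁ → LoHi _<₀_ a₀ b₀ → LoHi _<₁_ a₁ b₁ →
                  ∃ λ z → (AboveLo _<₀_ a₀ z × BelowHi _<₀_ z b₀)
                        × (AboveLo _<₁_ a₁ z × BelowHi _<₁_ z b₁)
    dense    : ∀ a b → a <₀ b → ∃ λ c → Lt∞ _<₀_ (just a) (v c) × Lt∞ _<₀_ (v c) (just b)

data Term (K : Set) (n : ℕ) : Set where
  var  : Fin n → Term K n
  `0   : Term K n
  `∞   : Term K n
  _`+_ : Term K n → Term K n → Term K n
  `λ   : K → Term K n → Term K n
  `v   : Term K n → Term K n

data Formula (K : Set) : ℕ → Set where
  _`≡_  : ∀ {n} → Term K n → Term K n → Formula K n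
  _`<₀_ : ∀ {n} → Term K n → Term K n → Formula K n
  _`<₁_ : ∀ {n} → Term K n → Term K n → Formula K n
  `¬    : ∀ {n} → Formula K n → Formula K n
  _`∧_  : ∀ {n} → Formula K n → Formula K n → Formula K n
  `∃    : ∀ {n} → Formula K (suc n) → Formula K n

module Semantics {C : OrderedField} (M : HamelSpace C) where
  open HamelSpace M

  U : Set
  U = Maybe Carrier

  add∞ : U → U → U
  add∞ (just a) (just b) = just (a + b)
  add∞ _        _        = nothing

  scal∞ : C.Carrier → U → U
  scal∞ c (just a) = just (c · a)
  scal∞ c nothing  = nothing

  v∞ : U → U
  v∞ (just a) = v a
  v∞ nothing  = nothing

  eval : ∀ {n} → Term C.Carrier n → (Fin n → U) → U
  eval (var i)   ρ = ρ i
  eval `0        ρ = just 0#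
  eval `∞        ρ = nothing
  eval (s `+ t)  ρ = add∞ (eval s ρ) (eval t ρ)
  eval (`λ c t)  ρ = scal∞ c (eval t ρ)
  eval (`v t)    ρ = v∞ (eval t ρ)

  cons : ∀ {n} → U → (Fin n → U) → Fin (suc n) → U
  cons a ρ Fin.zero    = a
  cons a ρ (Fin.suc i) = ρ i

  Sat : ∀ {n} → Formula C.Carrier n → (Fin n → U) → Set
  Sat (s `≡ t)  ρ = eval s ρ ≡ eval t ρ
  Sat (s `<₀ t) ρ = Lt∞ _<₀_ (eval s ρ) (eval t ρ)
  Sat (s `<₁ t) ρ = Lt∞ _<₁_ (eval s ρ) (eval t ρ)
  Sat (`¬ φ)    ρ = ¬ Sat φ ρ
  Sat (φ `∧ ψ)  ρ = Sat φ ρ × Sat ψ ρ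
  Sat (`∃ φ)    ρ = Σ U λ a → Sat φ (cons a ρ)

  SatXY : ∀ {k m} → Formula C.Carrier (k ℕ.+ m) → (Fin k → U) → (Fin m → U) → Set
  SatXY φ a b = Sat φ (a ++ b)

-- Patterns.  Consistency of a set of formulas with parameters in the
-- model M of the complete theory T_Ham is finite satisfiability in M.

-- ω-indexed pattern (used for strong dependence):
-- {φ_n(x;b_{n,η(n)}) : n<ω} ∪ {¬φ_n(x;b_{n,j}) : n<ω, j≠η(n)} consistent
ωPattern : {C : OrderedField} → (M : HamelSpace C) → (k : ℕ) →
           (m : ℕ → ℕ) → ((n : ℕ) → Formula (OrderedField.Carrier C) (k ℕ.+ m n)) →
           ((n j : ℕ) → Fin (m n) → Semantics.U M) → Set
ωPattern M k m φ b =
  ∀ (η : ℕ → ℕ) (N J : ℕ) → ∃ λ (a : Fin k → U) →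
    ∀ n → n ℕ.< N →
      SatXY (φ n) a (b n (η n)) × (∀ j → j ℕ.< J → j ≢ η n → ¬ SatXY (φ n) a (b n j))
  where open Semantics M

StronglyDependent : OrderedField → Set₁
StronglyDependent C =
  ∀ (M : HamelSpace C) (k : ℕ) (m : ℕ → ℕ)
    (φ : (n : ℕ) → Formula (OrderedField.Carrier C) (k ℕ.+ m n))
    (b : (n j : ℕ) → Fin (m n) → Semantics.U M) →
    ¬ ωPattern M k m φ b

ictPattern : {C : OrderedField} → (M : HamelSpace C) → (d : ℕ) →
             (m : Fin d → ℕ) → ((α : Fin d) → Formula (OrderedField.Carrier C) (1 ℕ.+ m α)) →
             ((α : Fin d) (j : ℕ) → Fin (m α) → Semantics.U M) → Set
ictPattern M d m φ b =
  ∀ (η : Fin d → ℕ) (J : ℕ) → ∃ λ (a : Fin 1 → U) →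
    ∀ α → SatXY (φ α) a (b α (η α)) × (∀ j → j ℕ.< J → j ≢ η α → ¬ SatXY (φ α) a (b α j))
  where open Semantics M

-- dp-rank of T (i.e. of x = x with |x| = 1) is < d : no ict pattern of depth d
dpRank< : OrderedField → ℕ → Set₁
dpRank< C d =
  ∀ (M : HamelSpace C) (m : Fin d → ℕ)
    (φ : (α : Fin d) → Formula (OrderedField.Carrier C) (1 ℕ.+ m α))
    (b : (α : Fin d) (j : ℕ) → Fin (m α) → Semantics.U M) →
    ¬ ictPattern M d m φ b

DpMinimal : OrderedField → Set₁
DpMinimal C = dpRank< C 2

FiniteDpRank : OrderedField → Set₁
FiniteDpRank C = ∃ λ d → dpRank< C d

{-# OPTIONS --safe #-}
-- A model G is the free C-module on the finite binary trees with labels in C.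
-- A tree s codes a combination d_s of basis vectors e_t with t a subtree of s,
-- and we put ε_s = e_s - d_s.  Then G is ordered by <₀ lexicographically in
-- the coordinates of the basis ε, small trees first, and by <₁ lexicographically
-- in those of the basis e, the vector e_s that is least for <₀ coming first; v(x)
-- is the leading basis vector e_s of x for <₁.  Every element of G has arbitrarily
-- large codes s, so vectors e_s = d_s + ε_s occur <₀-infinitely close to it.
--
-- In the model let the vectors b_{n,j} of the basis e be distinct for fixed n,
-- with b_{n,i} <₀ b_{n+1,j}.  Then b_{0,η(0)} + ... + b_{N-1,η(N-1)} can be
-- peeled off term by term by x ↦ x - v(x), so its n-th leading vector, a
-- term in x, is exactly b_{n,η(n)}.
module Submission where

open import Defs
open import Algebra.Bundles using (CommutativeRing; Group)
open import Algebra.Structures using (IsAbelianGroup)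
import Algebra.Properties.CommutativeSemigroup as CommutativeSemigroupProperties
import Algebra.Properties.Group as GroupProperties
import Algebra.Properties.Ring as RingProperties
open import Data.List using (List; []; _∷_; _++_; map)
open import Data.List.Membership.Propositional using (_∈_; _∉_)
open import Data.List.Membership.Propositional.Properties using (∈-++⁺ˡ; ∈-++⁺ʳ)
open import Data.List.Relation.Unary.All as All using (All; []; _∷_)
open import Data.List.Relation.Unary.AllPairs as AllPairs using (AllPairs; []; _∷_)
open import Data.List.Relation.Unary.Any using (here; there)
open import Data.Fin as Fin using (Fin)
import Data.Fin.Properties as FinP
open import Data.Maybe using (Maybe; just; nothing)
open import Data.Maybe.Properties using (just-injective)
open import Data.Nat as ℕ using (ℕ; zero; suc)
import Data.Nat.Properties as ℕ
open import Data.Product using (∃; _×_; _,_; proj₁; proj₂)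
open import Data.Sum using (_⊎_; inj₁; inj₂)
open import Function using (_∘_; const)
open import Relation.Binary.Definitions using (Transitive; Tri; tri<; tri≈; tri>)
open import Relation.Binary.PropositionalEquality
open import Relation.Binary.Structures using (IsStrictTotalOrder)
open import Relation.Binary.Structures.Biased using (isStrictTotalOrderᶜ)
open import Relation.Nullary using (¬_; Dec; yes; no; contradiction; recompute; ¬?; _×-dec_)

-- Strict total orders.

Connex : {A : Set} → (A → A → Set) → Set
Connex _<_ = ∀ x y → x < y ⊎ x ≡ y ⊎ y < x

connex⇒sto : {A : Set} {_<_ : A → A → Set} → Transitive _<_ → (∀ {x} → ¬ x < x) →
             Connex _<_ → IsStrictTotalOrder _≡_ _<_
connex⇒sto {_<_ = _<_} <-trans <-irrefl connex = isStrictTotalOrderᶜ record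
  { isEquivalence = isEquivalence
  ; trans         = <-trans
  ; compare       = compare
  }
  where
  compare : ∀ x y → Tri (x < y) (x ≡ y) (y < x)
  compare x y with connex x y
  ... | inj₁ x<y         = tri< x<y (λ { refl → <-irrefl x<y }) (<-irrefl ∘ <-trans x<y)
  ... | inj₂ (inj₁ refl) = tri≈ <-irrefl refl <-irrefl
  ... | inj₂ (inj₂ x>y)  = tri> (<-irrefl ∘ <-trans x>y) (λ { refl → <-irrefl x>y }) x>y

module StrictTotalOrder {A : Set} {_<_ : A → A → Set} (sto : IsStrictTotalOrder _≡_ _<_) where
  open IsStrictTotalOrder sto public using (compare; _≟_; _<?_) renaming (trans to <-trans)

  <-irrefl : ∀ {x} → ¬ x < x
  <-irrefl = IsStrictTotalOrder.irrefl sto refl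

  <-connex : Connex _<_
  <-connex x y with compare x y
  ... | tri< x<y _ _ = inj₁ x<y
  ... | tri≈ _ x≡y _ = inj₂ (inj₁ x≡y)
  ... | tri> _ _ x>y = inj₂ (inj₂ x>y)

-- Arithmetic of ordered fields.

module OrderedFieldProperties (C : OrderedField) where
  open OrderedField C public
    renaming ( Carrier to A; _+_ to infixl 6 _+_; _*_ to infixl 7 _*_; -_ to infix 8 -_
             ; _<_ to infix 4 _<_ )

  commutativeRing : CommutativeRing _ _
  commutativeRing = record { isCommutativeRing = isCommutativeRing }

  open CommutativeRing commutativeRing public using
    ( +-assoc; +-comm; +-identityˡ; +-identityʳ; -‿inverseˡ; -‿inverseʳ
    ; *-assoc; *-comm; *-identityˡ; *-identityʳ; distribˡ; distribʳ; zeroˡ; zeroʳ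
    ; ring; +-group; +-commutativeSemigroup )
  open RingProperties ring public using (-1*x≈-x)
  open GroupProperties +-group public using (∙-cancelˡ; ⁻¹-involutive)
  open CommutativeSemigroupProperties +-commutativeSemigroup public using (x∙yz≈y∙xz)
  open StrictTotalOrder isStrictTotalOrder public

  x<0⇒0<-x : ∀ {x} → x < 0# → 0# < - x
  x<0⇒0<-x {x} x<0 = subst₂ _<_ (-‿inverseʳ x) (+-identityˡ (- x)) (+-mono (- x) x<0)

  -- If 1 were negative, -1 would be positive, and so would its square, which is 1.
  0<1 : 0# < 1#
  0<1 with <-connex 0# 1#
  ... | inj₁ 0<1        = 0<1
  ... | inj₂ (inj₁ 0≡1) = contradiction 0≡1 0≢1
  ... | inj₂ (inj₂ 1<0) = subst (0# <_) -1*-1≡1 (*-pos 0<-1 0<-1)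
    where
    0<-1 : 0# < - 1#
    0<-1 = x<0⇒0<-x 1<0
    -1*-1≡1 : (- 1#) * (- 1#) ≡ 1#
    -1*-1≡1 = trans (-1*x≈-x (- 1#)) (⁻¹-involutive 1#)

  x<1+x : ∀ x → x < 1# + x
  x<1+x x = subst (_< 1# + x) (+-identityˡ x) (+-mono x 0<1)

  xy≡0⇒y≡0 : ∀ {x y} → x ≢ 0# → x * y ≡ 0# → y ≡ 0#
  xy≡0⇒y≡0 {x} {y} x≢0 xy≡0 with inverse x x≢0
  ... | x⁻¹ , xx⁻¹≡1 = begin
    y               ≡⟨ *-identityˡ y ⟨
    1# * y          ≡⟨ cong (_* y) (trans (*-comm x⁻¹ x) xx⁻¹≡1) ⟨
    (x⁻¹ * x) * y   ≡⟨ *-assoc x⁻¹ x y ⟩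
    x⁻¹ * (x * y)   ≡⟨ cong (x⁻¹ *_) xy≡0 ⟩
    x⁻¹ * 0#        ≡⟨ zeroʳ x⁻¹ ⟩
    0#              ∎
    where open ≡-Reasoning

-- Lexicographic comparison of functions with finite support.

module Lexicographic (C : OrderedField) {K : Set} {_≺_ : K → K → Set}
                     (sto : IsStrictTotalOrder _≡_ _≺_) where
  open OrderedFieldProperties C
  private module ≺ = StrictTotalOrder sto

  _≺lex_ : (K → A) → (K → A) → Set
  f ≺lex g = ∃ λ k → f k < g k × (∀ {i} → i ≺ k → f i ≡ g i)

  -- The earlier of the two deciding places decides the composite.
  ≺lex-trans : ∀ {f g h} → f ≺lex g → g ≺lex h → f ≺lex h
  ≺lex-trans {f} {h = h} (k , fk<gk , f≡g) (l , gl<hl , g≡h) with ≺.<-connex k l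
  ... | inj₁ k≺l         = k , subst (f k <_) (g≡h k≺l) fk<gk ,
                           λ i≺k → trans (f≡g i≺k) (g≡h (≺.<-trans i≺k k≺l))
  ... | inj₂ (inj₁ refl) = k , <-trans fk<gk gl<hl , λ i≺k → trans (f≡g i≺k) (g≡h i≺k)
  ... | inj₂ (inj₂ l≺k)  = l , subst (_< h l) (sym (f≡g l≺k)) gl<hl ,
                           λ i≺l → trans (f≡g (≺.<-trans i≺l l≺k)) (g≡h i≺l)

  ≺lex-irrefl : ∀ {f} → ¬ f ≺lex f
  ≺lex-irrefl (_ , fk<fk , _) = <-irrefl fk<fk

  -- Agreement before `k` is claimed only at members of `l`, so that the induction on the list goes
  -- through.
  first-difference : ∀ (f g : K → A) l → (∀ {i} → i ∈ l → f i ≡ g i) ⊎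
                     (∃ λ k → f k ≢ g k × (∀ {i} → i ∈ l → i ≺ k → f i ≡ g i))
  first-difference f g [] = inj₁ λ ()
  first-difference f g (j ∷ l) with first-difference f g l | f j ≟ g j
  ... | inj₁ f≡g             | yes fj≡gj = inj₁ λ { (here refl) → fj≡gj ; (there i∈l) → f≡g i∈l }
  ... | inj₁ f≡g             | no fj≢gj  = inj₂ (j , fj≢gj , λ
    { (here refl) j≺j → contradiction j≺j ≺.<-irrefl ; (there i∈l) _ → f≡g i∈l })
  ... | inj₂ (k , fk≢gk , e) | yes fj≡gj = inj₂ (k , fk≢gk , λ
    { (here refl) _ → fj≡gj ; (there i∈l) → e i∈l })
  ... | inj₂ (k , fk≢gk , e) | no fj≢gj with ≺.<-connex j k
  ...   | inj₁ j≺k         = inj₂ (j , fj≢gj , λ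
    { (here refl) j≺j → contradiction j≺j ≺.<-irrefl ; (there i∈l) i≺j → e i∈l (≺.<-trans i≺j j≺k) })
  ...   | inj₂ (inj₁ refl) = inj₂ (k , fk≢gk , λ
    { (here refl) j≺j → contradiction j≺j ≺.<-irrefl ; (there i∈l) → e i∈l })
  ...   | inj₂ (inj₂ k≺j)  = inj₂ (k , fk≢gk , λ
    { (here refl) j≺k → contradiction (≺.<-trans j≺k k≺j) ≺.<-irrefl ; (there i∈l) → e i∈l })

  open import Data.List.Membership.DecPropositional ≺._≟_ using (_∈?_)

  -- Finite support does the work of well-foundedness, which the dense order `◃` used below lacks.
  first-difference-supported : ∀ (f g : K → A) l → (∀ {i} → i ∉ l → f i ≡ g i) → (∀ i → f i ≡ g i) ⊎
                               (∃ λ k → f k ≢ g k × (∀ {i} → i ≺ k → f i ≡ g i))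
  first-difference-supported f g l outside with first-difference f g l
  ... | inj₁ f≡g = inj₁ λ i → helper i
    where
    helper : ∀ i → f i ≡ g i
    helper i with i ∈? l
    ... | yes i∈l = f≡g i∈l
    ... | no  i∉l = outside i∉l
  ... | inj₂ (k , fk≢gk , e) = inj₂ (k , fk≢gk , helper)
    where
    helper : ∀ {i} → i ≺ k → f i ≡ g i
    helper {i} i≺k with i ∈? l
    ... | yes i∈l = e i∈l i≺k
    ... | no  i∉l = outside i∉l

  ≺lex-connex : ∀ (f g : K → A) l → (∀ {i} → i ∉ l → f i ≡ g i) →
                f ≺lex g ⊎ (∀ i → f i ≡ g i) ⊎ g ≺lex f
  ≺lex-connex f g l outside with first-difference-supported f g l outside
  ... | inj₁ f≡g             = inj₂ (inj₁ f≡g)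
  ... | inj₂ (k , fk≢gk , e) with <-connex (f k) (g k)
  ...   | inj₁ fk<gk         = inj₁ (k , fk<gk , e)
  ...   | inj₂ (inj₁ fk≡gk)  = contradiction fk≡gk fk≢gk
  ...   | inj₂ (inj₂ gk<fk)  = inj₂ (inj₂ (k , gk<fk , sym ∘ e))

-- Free modules by normal forms.

-- Strictly decreasing lists of keys with non-zero coefficients make propositional
-- equality the right equality; the proof of this normal form is irrelevant so that
-- it does not interfere.
module FreeModule (C : OrderedField) {K : Set} {_≺_ : K → K → Set}
                  (sto : IsStrictTotalOrder _≡_ _≺_) where
  open OrderedFieldProperties C
  private module ≺ = StrictTotalOrder sto

  Raw : Set
  Raw = List (K × A)

  _≻ᵏ_ : K × A → K × A → Set
  p ≻ᵏ q = proj₁ q ≺ proj₁ p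

  NonZeroCoef : K × A → Set
  NonZeroCoef p = proj₂ p ≢ 0#

  Normal : Raw → Set
  Normal l = AllPairs _≻ᵏ_ l × All NonZeroCoef l

  normal? : ∀ l → Dec (Normal l)
  normal? l = AllPairs.allPairs? (λ p q → proj₁ q ≺.<? proj₁ p) l
              ×-dec All.all? (λ p → ¬? (proj₂ p ≟ 0#)) l

  -- The linear functional with values `w` on the basis. All coordinates used below are instances:
  -- `δ i` gives those of the basis e, `ε i` those of the basis ε.
  extend : (K → A) → Raw → A
  extend w []            = 0#
  extend w ((k , c) ∷ l) = c * w k + extend w l

  extend-++ : ∀ w l l' → extend w (l ++ l') ≡ extend w l + extend w l'
  extend-++ w []            l' = sym (+-identityˡ _)
  extend-++ w ((k , c) ∷ l) l' =
    trans (cong (c * w k +_) (extend-++ w l l')) (sym (+-assoc _ _ _))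

  scale : A → K × A → K × A
  scale a (k , c) = k , a * c

  extend-scale : ∀ w a l → extend w (map (scale a) l) ≡ a * extend w l
  extend-scale w a []            = sym (zeroʳ a)
  extend-scale w a ((k , c) ∷ l) =
    trans (cong₂ _+_ (*-assoc a c (w k)) (extend-scale w a l)) (sym (distribˡ a _ _))

  extend-vanish : ∀ w {l} → All (λ p → w (proj₁ p) ≡ 0#) l → extend w l ≡ 0#
  extend-vanish w []                            = refl
  extend-vanish w (_∷_ {x = k , c} wk≡0 rest) = trans
    (cong₂ _+_ (trans (cong (c *_) wk≡0) (zeroʳ c)) (extend-vanish w rest)) (+-identityˡ 0#)

  prepend : K → A → Raw → Raw
  prepend k c l with c ≟ 0#
  ... | yes _ = l
  ... | no  _ = (k , c) ∷ l

  insert : K → A → Raw → Raw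
  insert k c []            = prepend k c []
  insert k c ((i , d) ∷ l) with ≺.compare k i
  ... | tri< _ _ _ = (i , d) ∷ insert k c l
  ... | tri≈ _ _ _ = prepend i (c + d) l
  ... | tri> _ _ _ = prepend k c ((i , d) ∷ l)

  extend-prepend : ∀ w k c l → extend w (prepend k c l) ≡ c * w k + extend w l
  extend-prepend w k c l with c ≟ 0#
  ... | yes refl = sym (trans (cong (_+ extend w l) (zeroˡ (w k))) (+-identityˡ _))
  ... | no  _    = refl

  extend-insert : ∀ w k c l → extend w (insert k c l) ≡ c * w k + extend w l
  extend-insert w k c []            = extend-prepend w k c []
  extend-insert w k c ((i , d) ∷ l) with ≺.compare k i
  ... | tri< _ _ _    = trans (cong (d * w i +_) (extend-insert w k c l)) (x∙yz≈y∙xz _ _ _)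
  ... | tri≈ _ refl _ = trans (extend-prepend w k (c + d) l)
                        (trans (cong (_+ extend w l) (distribʳ (w k) c d)) (+-assoc _ _ _))
  ... | tri> _ _ _    = extend-prepend w k c ((i , d) ∷ l)

  prepend-normal : ∀ {k c l} → All (λ q → proj₁ q ≺ k) l → Normal l → Normal (prepend k c l)
  prepend-normal {c = c} l≺k (pairs , nz) with c ≟ 0#
  ... | yes _   = pairs , nz
  ... | no  c≢0 = l≺k ∷ pairs , c≢0 ∷ nz

  prepend-keys : ∀ {P : K → Set} {k c l} → P k → All (P ∘ proj₁) l → All (P ∘ proj₁) (prepend k c l)
  prepend-keys {c = c} pk pl with c ≟ 0#
  ... | yes _ = pl
  ... | no  _ = pk ∷ pl

  insert-keys : ∀ {P : K → Set} {k c} l → P k → All (P ∘ proj₁) l → All (P ∘ proj₁) (insert k c l)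
  insert-keys {P} {k} {c} [] pk [] = prepend-keys {P} {c = c} pk []
  insert-keys {P} {k} {c} ((i , d) ∷ l) pk (pi ∷ pl) with ≺.compare k i
  ... | tri< _ _ _ = pi ∷ insert-keys {P} l pk pl
  ... | tri≈ _ _ _ = prepend-keys {P} {c = c + d} pi pl
  ... | tri> _ _ _ = prepend-keys {P} {c = c} pk (pi ∷ pl)

  insert-normal : ∀ k c l → Normal l → Normal (insert k c l)
  insert-normal k c [] nl = prepend-normal {c = c} [] nl
  insert-normal k c ((i , d) ∷ l) nl@(l≺i ∷ pairs , d≢0 ∷ nz) with ≺.compare k i
  ... | tri< k≺i _ _ = let pairs' , nz' = insert-normal k c l (pairs , nz) in
                       insert-keys {_≺ i} l k≺i l≺i ∷ pairs' , d≢0 ∷ nz'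
  ... | tri≈ _ _ _   = prepend-normal {c = c + d} l≺i (pairs , nz)
  ... | tri> _ _ i≺k = prepend-normal {c = c} (i≺k ∷ All.map (λ j≺i → ≺.<-trans j≺i i≺k) l≺i) nl

  record Free : Set where
    constructor free
    field
      terms   : Raw
      .normal : Normal terms
  open Free public using (terms)

  -- Normality is decidable, so a usable proof can be recovered from the irrelevant field.
  isNormal : ∀ x → Normal (terms x)
  isNormal (free l n) = recompute (normal? l) n

  -- From here on, a normalised list is known only through its normality and the values of
  -- functionals on it.
  abstract
    normalise : Raw → Raw
    normalise []            = []
    normalise ((k , c) ∷ l) = insert k c (normalise l)

    normalise-normal : ∀ l → Normal (normalise l)
    normalise-normal []            = [] , []
    normalise-normal ((k , c) ∷ l) = insert-normal k c (normalise l) (normalise-normal l)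

    extend-normalise : ∀ w l → extend w (normalise l) ≡ extend w l
    extend-normalise w []            = refl
    extend-normalise w ((k , c) ∷ l) =
      trans (extend-insert w k c (normalise l)) (cong (c * w k +_) (extend-normalise w l))

  ⟦_⟧ : Raw → Free
  ⟦ l ⟧ = free (normalise l) (normalise-normal l)

  infixl 6 _⊕_
  infixl 7 _⊙_

  𝟘 : Free
  𝟘 = free [] ([] , [])

  single : K → Free
  single k = ⟦ (k , 1#) ∷ [] ⟧

  _⊕_ : Free → Free → Free
  x ⊕ y = ⟦ terms x ++ terms y ⟧

  _⊙_ : A → Free → Free
  a ⊙ x = ⟦ map (scale a) (terms x) ⟧

  ⊖_ : Free → Free
  ⊖ x = (- 1#) ⊙ x

  module LinearExtension (w : K → A) where
    ext : Free → A
    ext x = extend w (terms x)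

    ext-⊕ : ∀ x y → ext (x ⊕ y) ≡ ext x + ext y
    ext-⊕ x y = trans (extend-normalise w (terms x ++ terms y)) (extend-++ w (terms x) (terms y))

    ext-⊙ : ∀ a x → ext (a ⊙ x) ≡ a * ext x
    ext-⊙ a x = trans (extend-normalise w (map (scale a) (terms x))) (extend-scale w a (terms x))

    ext-⊖ : ∀ x → ext (⊖ x) ≡ - ext x
    ext-⊖ x = trans (ext-⊙ (- 1#) x) (-1*x≈-x (ext x))

    ext-single : ∀ k → ext (single k) ≡ w k
    ext-single k = trans (extend-normalise w ((k , 1#) ∷ []))
      (trans (+-identityʳ _) (*-identityˡ (w k)))

  open LinearExtension public

  δ : K → K → A
  δ i k with k ≺.≟ i
  ... | yes _ = 1#
  ... | no  _ = 0#

  δ-refl : ∀ i → δ i i ≡ 1#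
  δ-refl i with i ≺.≟ i
  ... | yes _  = refl
  ... | no i≢i = contradiction refl i≢i

  δ-≢ : ∀ {i k} → k ≢ i → δ i k ≡ 0#
  δ-≢ {i} {k} k≢i with k ≺.≟ i
  ... | yes k≡i = contradiction k≡i k≢i
  ... | no _    = refl

  coefʳ : Raw → K → A
  coefʳ l i = extend (δ i) l

  coef : Free → K → A
  coef x i = coefʳ (terms x) i

  coefʳ-≢ : ∀ {i l} → All (λ p → proj₁ p ≢ i) l → coefʳ l i ≡ 0#
  coefʳ-≢ {i} = extend-vanish (δ i) ∘ All.map δ-≢

  coefʳ-≺ : ∀ {i l} → All (λ p → proj₁ p ≺ i) l → coefʳ l i ≡ 0#
  coefʳ-≺ = coefʳ-≢ ∘ All.map λ { k≺k refl → ≺.<-irrefl k≺k }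

  coefʳ-head : ∀ {k c l} → All (λ p → proj₁ p ≺ k) l → coefʳ ((k , c) ∷ l) k ≡ c
  coefʳ-head {k} {c} {l} l≺k = trans
    (cong₂ _+_ (trans (cong (c *_) (δ-refl k)) (*-identityʳ c)) (coefʳ-≺ l≺k)) (+-identityʳ c)

  -- Heads carry the greatest keys. If these differ, the greater one has coefficient 0 in the other
  -- list, which is impossible; if they agree, so do the head terms, and cancelling them leaves the
  -- tails.
  coefʳ-injective : ∀ {l m} → Normal l → Normal m → (∀ i → coefʳ l i ≡ coefʳ m i) → l ≡ m
  coefʳ-injective {[]} {[]} _ _ _ = refl
  coefʳ-injective {[]} {(k , c) ∷ m} _ (m≺k ∷ _ , c≢0 ∷ _) e =
    contradiction (trans (sym (coefʳ-head m≺k)) (sym (e k))) c≢0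
  coefʳ-injective {(k , c) ∷ l} {[]} (l≺k ∷ _ , c≢0 ∷ _) _ e =
    contradiction (trans (sym (coefʳ-head l≺k)) (e k)) c≢0
  coefʳ-injective {(k , c) ∷ l} {(k' , c') ∷ m} (l≺k ∷ pl , c≢0 ∷ nl) (m≺k' ∷ pm , c'≢0 ∷ nm) e
    with ≺.<-connex k k'
  ... | inj₁ k≺k' = contradiction
    (trans (sym (coefʳ-head m≺k')) (trans (sym (e k'))
      (coefʳ-≺ (k≺k' ∷ All.map (λ i≺k → ≺.<-trans i≺k k≺k') l≺k)))) c'≢0
  ... | inj₂ (inj₂ k'≺k) = contradiction
    (trans (sym (coefʳ-head l≺k)) (trans (e k)
      (coefʳ-≺ (k'≺k ∷ All.map (λ i≺k' → ≺.<-trans i≺k' k'≺k) m≺k')))) c≢0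
  ... | inj₂ (inj₁ refl) with trans (sym (coefʳ-head l≺k)) (trans (e k) (coefʳ-head m≺k'))
  ...   | refl = cong ((k , c) ∷_) (coefʳ-injective (pl , nl) (pm , nm)
                   λ i → ∙-cancelˡ (c * δ i k) _ _ (e i))

  coef-injective : ∀ {x y} → (∀ i → coef x i ≡ coef y i) → x ≡ y
  coef-injective {x} {y} e = helper (coefʳ-injective (isNormal x) (isNormal y) e)
    where
    helper : terms x ≡ terms y → x ≡ y
    helper refl = refl

  coef-⊕ : ∀ x y i → coef (x ⊕ y) i ≡ coef x i + coef y i
  coef-⊕ x y i = ext-⊕ (δ i) x y

  coef-⊙ : ∀ a x i → coef (a ⊙ x) i ≡ a * coef x i
  coef-⊙ a x i = ext-⊙ (δ i) a x

  coef-⊖ : ∀ x i → coef (⊖ x) i ≡ - coef x i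
  coef-⊖ x i = ext-⊖ (δ i) x

  coef-single : ∀ k i → coef (single k) i ≡ δ i k
  coef-single k i = ext-single (δ i) k

  coef-single-refl : ∀ k → coef (single k) k ≡ 1#
  coef-single-refl k = trans (coef-single k k) (δ-refl k)

  coef-single-≢ : ∀ {k i} → k ≢ i → coef (single k) i ≡ 0#
  coef-single-≢ {k} {i} k≢i = trans (coef-single k i) (δ-≢ k≢i)

  single-injective : ∀ {j k} → single j ≡ single k → j ≡ k
  single-injective {j} {k} e with j ≺.≟ k
  ... | yes j≡k = j≡k
  ... | no  j≢k = contradiction
    (trans (sym (coef-single-≢ j≢k)) (trans (cong (λ x → coef x k) e) (coef-single-refl k))) 0≢1

  keys : Free → List K
  keys x = map proj₁ (terms x)

  coef-∉ : ∀ x {i} → i ∉ keys x → coef x i ≡ 0#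
  coef-∉ x i∉ = coefʳ-≢ (helper (terms x) i∉)
    where
    helper : ∀ l {i} → i ∉ map proj₁ l → All (λ p → proj₁ p ≢ i) l
    helper []      _  = []
    helper (p ∷ l) i∉ = (λ { refl → i∉ (here refl) }) ∷ helper l (i∉ ∘ there)

  -- Vector space axioms, checked coefficientwise.

  ⊕-assoc : ∀ x y z → (x ⊕ y) ⊕ z ≡ x ⊕ (y ⊕ z)
  ⊕-assoc x y z = coef-injective λ i → begin
    coef (x ⊕ y ⊕ z) i                ≡⟨ coef-⊕ (x ⊕ y) z i ⟩
    coef (x ⊕ y) i + coef z i         ≡⟨ cong (_+ coef z i) (coef-⊕ x y i) ⟩
    (coef x i + coef y i) + coef z i  ≡⟨ +-assoc _ _ _ ⟩
    coef x i + (coef y i + coef z i)  ≡⟨ cong (coef x i +_) (coef-⊕ y z i) ⟨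
    coef x i + coef (y ⊕ z) i         ≡⟨ coef-⊕ x (y ⊕ z) i ⟨
    coef (x ⊕ (y ⊕ z)) i              ∎
    where open ≡-Reasoning

  ⊕-comm : ∀ x y → x ⊕ y ≡ y ⊕ x
  ⊕-comm x y = coef-injective λ i →
    trans (coef-⊕ x y i) (trans (+-comm _ _) (sym (coef-⊕ y x i)))

  ⊕-identityˡ : ∀ x → 𝟘 ⊕ x ≡ x
  ⊕-identityˡ x = coef-injective λ i → trans (coef-⊕ 𝟘 x i) (+-identityˡ _)

  ⊕-inverseˡ : ∀ x → (⊖ x) ⊕ x ≡ 𝟘
  ⊕-inverseˡ x = coef-injective λ i →
    trans (coef-⊕ (⊖ x) x i) (trans (cong (_+ coef x i) (coef-⊖ x i)) (-‿inverseˡ _))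

  ⊕-isAbelianGroup : IsAbelianGroup _≡_ _⊕_ 𝟘 ⊖_
  ⊕-isAbelianGroup = record
    { isGroup = record
      { isMonoid = record
        { isSemigroup = record
          { isMagma = record { isEquivalence = isEquivalence ; ∙-cong = cong₂ _⊕_ }
          ; assoc = ⊕-assoc
          }
        ; identity = ⊕-identityˡ , λ x → trans (⊕-comm x 𝟘) (⊕-identityˡ x)
        }
      ; inverse = ⊕-inverseˡ , λ x → trans (⊕-comm x (⊖ x)) (⊕-inverseˡ x)
      ; ⁻¹-cong = cong ⊖_
      }
    ; comm = ⊕-comm
    }

  ⊙-assoc : ∀ a b x → (a * b) ⊙ x ≡ a ⊙ (b ⊙ x)
  ⊙-assoc a b x = coef-injective λ i → begin
    coef ((a * b) ⊙ x) i  ≡⟨ coef-⊙ (a * b) x i ⟩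
    (a * b) * coef x i    ≡⟨ *-assoc a b _ ⟩
    a * (b * coef x i)    ≡⟨ cong (a *_) (coef-⊙ b x i) ⟨
    a * coef (b ⊙ x) i    ≡⟨ coef-⊙ a (b ⊙ x) i ⟨
    coef (a ⊙ (b ⊙ x)) i  ∎
    where open ≡-Reasoning

  ⊙-unit : ∀ x → 1# ⊙ x ≡ x
  ⊙-unit x = coef-injective λ i → trans (coef-⊙ 1# x i) (*-identityˡ _)

  ⊙-distribˡ : ∀ a x y → a ⊙ (x ⊕ y) ≡ (a ⊙ x) ⊕ (a ⊙ y)
  ⊙-distribˡ a x y = coef-injective λ i → begin
    coef (a ⊙ (x ⊕ y)) i               ≡⟨ coef-⊙ a (x ⊕ y) i ⟩
    a * coef (x ⊕ y) i                 ≡⟨ cong (a *_) (coef-⊕ x y i) ⟩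
    a * (coef x i + coef y i)          ≡⟨ distribˡ a _ _ ⟩
    a * coef x i + a * coef y i        ≡⟨ cong₂ _+_ (coef-⊙ a x i) (coef-⊙ a y i) ⟨
    coef (a ⊙ x) i + coef (a ⊙ y) i    ≡⟨ coef-⊕ (a ⊙ x) (a ⊙ y) i ⟨
    coef ((a ⊙ x) ⊕ (a ⊙ y)) i         ∎
    where open ≡-Reasoning

  ⊙-distribʳ : ∀ a b x → (a + b) ⊙ x ≡ (a ⊙ x) ⊕ (b ⊙ x)
  ⊙-distribʳ a b x = coef-injective λ i → begin
    coef ((a + b) ⊙ x) i               ≡⟨ coef-⊙ (a + b) x i ⟩
    (a + b) * coef x i                 ≡⟨ distribʳ _ a b ⟩
    a * coef x i + b * coef x i        ≡⟨ cong₂ _+_ (coef-⊙ a x i) (coef-⊙ b x i) ⟨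
    coef (a ⊙ x) i + coef (b ⊙ x) i    ≡⟨ coef-⊕ (a ⊙ x) (b ⊙ x) i ⟨
    coef ((a ⊙ x) ⊕ (b ⊙ x)) i         ∎
    where open ≡-Reasoning

-- Lexicographic orders on free modules.

-- The lexicographic order on the free module on K in the coordinates whose
-- values on the basis are given by w.
module LexOrder (C : OrderedField) {K I : Set} {_≺ᴷ_ : K → K → Set} {_≺_ : I → I → Set}
                (stoᴷ : IsStrictTotalOrder _≡_ _≺ᴷ_) (sto : IsStrictTotalOrder _≡_ _≺_)
                (w : I → K → OrderedField.Carrier C) where
  open OrderedFieldProperties C
  open FreeModule C stoᴷ
  open Lexicographic C sto

  coords : Free → I → A
  coords x i = ext (w i) x

  -- A record rather than a synonym, so that x and y can be inferred from x ⊰ y.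
  record _⊰_ (x y : Free) : Set where
    constructor lex
    field
      unlex : coords x ≺lex coords y
  open _⊰_ public

  ⊰-⊕ : ∀ {x y} z → x ⊰ y → (x ⊕ z) ⊰ (y ⊕ z)
  ⊰-⊕ {x} {y} z (lex (k , xk<yk , e)) = lex (
    k , subst₂ _<_ (sym (ext-⊕ (w k) x z)) (sym (ext-⊕ (w k) y z)) (+-mono (coords z k) xk<yk) ,
    λ {i} i≺k → trans (ext-⊕ (w i) x z) (trans (cong (_+ coords z i) (e i≺k)) (sym (ext-⊕ (w i) y z))))

  ⊰-⊙ : ∀ {a x} → 0# < a → 𝟘 ⊰ x → 𝟘 ⊰ (a ⊙ x)
  ⊰-⊙ {a} {x} 0<a (lex (k , 0<xk , e)) = lex (
    k , subst (0# <_) (sym (ext-⊙ (w k) a x)) (*-pos 0<a 0<xk) ,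
    λ {i} i≺k → sym (trans (ext-⊙ (w i) a x) (trans (cong (a *_) (sym (e i≺k))) (zeroʳ a))))

  module Total (support : Free → List I)
               (outside : ∀ x {i} → i ∉ support x → coords x i ≡ 0#)
               (coords-injective : ∀ {x y} → (∀ i → coords x i ≡ coords y i) → x ≡ y) where

    ⊰-connex : Connex _⊰_
    -- Outside the two supports both vectors have coordinate 0, so the joined list contains every
    -- place where they can differ.
    ⊰-connex x y with ≺lex-connex (coords x) (coords y) (support x ++ support y)
      (λ i∉ → trans (outside x (i∉ ∘ ∈-++⁺ˡ)) (sym (outside y (i∉ ∘ ∈-++⁺ʳ (support x)))))
    ... | inj₁ x<y        = inj₁ (lex x<y)
    ... | inj₂ (inj₁ x≡y) = inj₂ (inj₁ (coords-injective x≡y))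
    ... | inj₂ (inj₂ y<x) = inj₂ (inj₂ (lex y<x))

    abstract
      ⊰-sto : IsStrictTotalOrder _≡_ _⊰_
      ⊰-sto = connex⇒sto (λ x<y y<z → lex (≺lex-trans (unlex x<y) (unlex y<z)))
                         (≺lex-irrefl ∘ unlex) ⊰-connex

-- Trees, the bases e and ε, and the two orders.

module Trees (C : OrderedField) where
  open OrderedFieldProperties C

  data Tree : Set where
    leaf : Tree
    node : A → Tree → Tree → Tree

  size : Tree → ℕ
  size leaf         = 0
  size (node _ s t) = suc (size s ℕ.+ size t)

  -- Breaks ties between trees of equal size.
  data _⊏_ : Tree → Tree → Set where
    leaf  : ∀ {c s t} → leaf ⊏ node c s t
    label : ∀ {c c' s s' t t'} → c < c' → node c s t ⊏ node c' s' t'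
    left  : ∀ {c s s' t t'} → s ⊏ s' → node c s t ⊏ node c s' t'
    right : ∀ {c s t t'} → t ⊏ t' → node c s t ⊏ node c s t'

  ⊏-trans : Transitive _⊏_
  ⊏-trans leaf      (label _) = leaf
  ⊏-trans leaf      (left _)  = leaf
  ⊏-trans leaf      (right _) = leaf
  ⊏-trans (label p) (label q) = label (<-trans p q)
  ⊏-trans (label p) (left q)  = label p
  ⊏-trans (label p) (right q) = label p
  ⊏-trans (left p)  (label q) = label q
  ⊏-trans (left p)  (left q)  = left (⊏-trans p q)
  ⊏-trans (left p)  (right q) = left p
  ⊏-trans (right p) (label q) = label q
  ⊏-trans (right p) (left q)  = left q
  ⊏-trans (right p) (right q) = right (⊏-trans p q)

  ⊏-irrefl : ∀ {t} → ¬ t ⊏ t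
  ⊏-irrefl (label p) = <-irrefl p
  ⊏-irrefl (left p)  = ⊏-irrefl p
  ⊏-irrefl (right p) = ⊏-irrefl p

  ⊏-connex : Connex _⊏_
  ⊏-connex leaf         leaf            = inj₂ (inj₁ refl)
  ⊏-connex leaf         (node _ _ _)    = inj₁ leaf
  ⊏-connex (node _ _ _) leaf            = inj₂ (inj₂ leaf)
  ⊏-connex (node c s t) (node c' s' t') with <-connex c c'
  ... | inj₁ p           = inj₁ (label p)
  ... | inj₂ (inj₂ p)    = inj₂ (inj₂ (label p))
  ... | inj₂ (inj₁ refl) with ⊏-connex s s'
  ...   | inj₁ p           = inj₁ (left p)
  ...   | inj₂ (inj₂ p)    = inj₂ (inj₂ (left p))
  ...   | inj₂ (inj₁ refl) with ⊏-connex t t'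
  ...     | inj₁ p           = inj₁ (right p)
  ...     | inj₂ (inj₂ p)    = inj₂ (inj₂ (right p))
  ...     | inj₂ (inj₁ refl) = inj₂ (inj₁ refl)

  -- Size comes first because a tree codes a vector in the ε of strictly smaller trees; this makes
  -- the change between e and ε unitriangular.
  data _≺_ (s t : Tree) : Set where
    smaller   : size s ℕ.< size t → s ≺ t
    same-size : size s ≡ size t → s ⊏ t → s ≺ t

  ≺⇒size≤ : ∀ {s t} → s ≺ t → size s ℕ.≤ size t
  ≺⇒size≤ (smaller p)     = ℕ.<⇒≤ p
  ≺⇒size≤ (same-size e _) = ℕ.≤-reflexive e

  ≺-trans : Transitive _≺_
  ≺-trans (smaller p)     q               = smaller (ℕ.<-≤-trans p (≺⇒size≤ q))
  ≺-trans (same-size e _) (smaller q)     = smaller (subst (ℕ._< _) (sym e) q)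
  ≺-trans (same-size e p) (same-size f q) = same-size (trans e f) (⊏-trans p q)

  ≺-irrefl : ∀ {t} → ¬ t ≺ t
  ≺-irrefl (smaller p)     = ℕ.<-irrefl refl p
  ≺-irrefl (same-size _ p) = ⊏-irrefl p

  ≺-connex : Connex _≺_
  ≺-connex s t with ℕ.<-cmp (size s) (size t) | ⊏-connex s t
  ... | tri< p _ _ | _                = inj₁ (smaller p)
  ... | tri> _ _ p | _                = inj₂ (inj₂ (smaller p))
  ... | tri≈ _ e _ | inj₁ p           = inj₁ (same-size e p)
  ... | tri≈ _ e _ | inj₂ (inj₁ refl) = inj₂ (inj₁ refl)
  ... | tri≈ _ e _ | inj₂ (inj₂ p)    = inj₂ (inj₂ (same-size (sym e) p))

  abstract
    ≺-sto : IsStrictTotalOrder _≡_ _≺_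
    ≺-sto = connex⇒sto ≺-trans ≺-irrefl ≺-connex

  ⊀leaf : ∀ {s} → ¬ s ≺ leaf
  ⊀leaf (smaller ())
  ⊀leaf (same-size _ ())

  open FreeModule C ≺-sto public

  -- Coordinate i of the vector coded by a tree: leaf codes 0, and node c s t
  -- codes c e_s plus the vector coded by t, where e_s = ε_s + (vector coded by s).
  decode : Tree → Tree → A
  decode i leaf         = 0#
  decode i (node c s t) = c * (δ i s + decode i s) + decode i t

  -- The coordinate at ε_i of the basis vector e_s.
  ε : Tree → Tree → A
  ε i s = δ i s + decode i s

  node-sizes : ∀ {i c s t} → size (node c s t) ℕ.≤ size i → s ≢ i × size s ℕ.≤ size i × size t ℕ.≤ size i
  node-sizes {i} {c} {s} {t} le =
    (λ { refl → ℕ.<-irrefl refl s<i }) , ℕ.<⇒≤ s<i ,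
    ℕ.≤-trans (ℕ.m≤n+m (size t) (suc (size s))) le
    where
    s<i : size s ℕ.< size i
    s<i = ℕ.≤-trans (ℕ.m≤m+n (suc (size s)) (size t)) le

  -- Only ε at trees strictly smaller than `t` occur in the vector that `t` codes. The induction
  -- alternates with the same claim for e_s, where the summand ε_s has to be excluded by `s ≢ i`.
  decode-vanish : ∀ {i} t → size t ℕ.≤ size i → decode i t ≡ 0#
  ε-vanish : ∀ {i} s → s ≢ i → size s ℕ.≤ size i → ε i s ≡ 0#

  decode-vanish leaf         le = refl
  decode-vanish {i} (node c s t) le =
    let s≢i , s≤i , t≤i = node-sizes {i} {c} {s} {t} le in
    trans (cong₂ _+_ (trans (cong (c *_) (ε-vanish s s≢i s≤i)) (zeroʳ c)) (decode-vanish t t≤i))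
          (+-identityʳ 0#)

  ε-vanish {i} s s≢i s≤i = trans (cong₂ _+_ (δ-≢ {i} s≢i) (decode-vanish s s≤i)) (+-identityʳ 0#)

  ε-diagonal : ∀ s → ε s s ≡ 1#
  ε-diagonal s = trans (cong₂ _+_ (δ-refl s) (decode-vanish s ℕ.≤-refl)) (+-identityʳ 1#)

  ε-≺ : ∀ {s i} → s ≺ i → ε i s ≡ 0#
  ε-≺ {s} s≺i = ε-vanish s (λ { refl → ≺-irrefl s≺i }) (≺⇒size≤ s≺i)

  support : Tree → List Tree
  support leaf         = []
  support (node c s t) = s ∷ support s ++ support t

  decode-∉ : ∀ {i} t → i ∉ support t → decode i t ≡ 0#
  decode-∉ leaf         i∉ = refl
  decode-∉ {i} (node c s t) i∉ = trans
    (cong₂ _+_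
      (trans (cong (c *_) (trans (cong₂ _+_ (δ-≢ {i} λ { refl → i∉ (here refl) })
                                            (decode-∉ s (i∉ ∘ there ∘ ∈-++⁺ˡ)))
                                 (+-identityʳ 0#)))
             (zeroʳ c))
      (decode-∉ t (i∉ ∘ there ∘ ∈-++⁺ʳ (support s))))
    (+-identityʳ 0#)

  code : Raw → Tree
  code []            = leaf
  code ((k , c) ∷ l) = node c k (code l)

  -- Every element of the module therefore has a code.
  decode-code : ∀ i l → decode i (code l) ≡ extend (ε i) l
  decode-code i []            = refl
  decode-code i ((k , c) ∷ l) = cong (c * ε i k +_) (decode-code i l)

  -- Adds terms with coefficient 0: the coded vector stays the same while the size grows at will.
  pad : ℕ → Tree → Tree
  pad zero    t = t
  pad (suc n) t = node 0# leaf (pad n t)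

  decode-pad : ∀ i n t → decode i (pad n t) ≡ decode i t
  decode-pad i zero    t = refl
  decode-pad i (suc n) t = trans (cong₂ _+_ (zeroˡ _) (decode-pad i n t)) (+-identityˡ _)

  size-pad : ∀ n t → size (pad n t) ≡ n ℕ.+ size t
  size-pad zero    t = refl
  size-pad (suc n) t = cong suc (size-pad n t)

  open LexOrder C ≺-sto ≺-sto ε public renaming
    ( coords to coords₀; _⊰_ to _<₀_; lex to lex₀; ⊰-⊕ to <₀-⊕; ⊰-⊙ to <₀-⊙
    ; module Total to Total₀ )

  -- The change of coordinates is unitriangular, so the greatest key survives.
  kernel : ∀ {l} → Normal l → (∀ i → extend (ε i) l ≡ 0#) → l ≡ []
  kernel {[]}          _                       _ = refl
  kernel {(k , c) ∷ l} (l≺k ∷ _ , c≢0 ∷ _) e = contradiction (trans (sym at-k) (e k)) c≢0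
    where
    at-k : extend (ε k) ((k , c) ∷ l) ≡ c
    at-k = trans (cong₂ _+_ (trans (cong (c *_) (ε-diagonal k)) (*-identityʳ c))
                            (extend-vanish (ε k) (All.map ε-≺ l≺k)))
                 (+-identityʳ c)

  ⊕-group : Group _ _
  ⊕-group = record { isGroup = IsAbelianGroup.isGroup ⊕-isAbelianGroup }

  open GroupProperties ⊕-group public
    using (x∙y⁻¹≈ε⇒x≈y; //-rightDividesˡ; //-rightDividesʳ)

  coords₀-injective : ∀ {x y} → (∀ i → coords₀ x i ≡ coords₀ y i) → x ≡ y
  coords₀-injective {x} {y} e = x∙y⁻¹≈ε⇒x≈y x y (helper (kernel (isNormal (x ⊕ (⊖ y))) difference))
    where
    difference : ∀ i → coords₀ (x ⊕ (⊖ y)) i ≡ 0#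
    difference i = trans (ext-⊕ (ε i) x (⊖ y)) (trans (cong₂ _+_ (e i) (ext-⊖ (ε i) y)) (-‿inverseʳ _))
    helper : ∀ {z} → terms z ≡ [] → z ≡ 𝟘
    helper refl = refl

  -- The trees inside a code of x bound the support of x in the basis ε.
  open Total₀ (support ∘ code ∘ terms)
    (λ x i∉ → trans (sym (decode-code _ (terms x))) (decode-∉ (code (terms x)) i∉))
    coords₀-injective public using () renaming (⊰-sto to <₀-sto)

  private module <₀ = StrictTotalOrder <₀-sto

  -- As the key order of `<₁`, this makes `<₀`-small basis vectors the most significant ones for
  -- `<₁`, hence the valuation order-reversing.
  _◃_ : Tree → Tree → Set
  j ◃ k = single j <₀ single k

  ◃-connex : Connex _◃_
  ◃-connex j k with <₀.<-connex (single j) (single k)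
  ... | inj₁ p        = inj₁ p
  ... | inj₂ (inj₁ e) = inj₂ (inj₁ (single-injective e))
  ... | inj₂ (inj₂ p) = inj₂ (inj₂ p)

  abstract
    ◃-sto : IsStrictTotalOrder _≡_ _◃_
    ◃-sto = connex⇒sto <₀.<-trans <₀.<-irrefl ◃-connex

  open LexOrder C ≺-sto ◃-sto δ public using () renaming
    (lex to lex₁; _⊰_ to _<₁_; ⊰-⊕ to <₁-⊕; ⊰-⊙ to <₁-⊙; module Total to Total₁)

  open Total₁ keys coef-∉ coef-injective public using () renaming (⊰-sto to <₁-sto)

-- The model: density of the basis e for `<₀`.

module HamelModel (C : OrderedField) where
  open OrderedFieldProperties C
  open Trees C
  private
    module <₀ = StrictTotalOrder <₀-sto
    module ◃ = StrictTotalOrder ◃-sto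

  ◃⇒≢ : ∀ {j k} → j ◃ k → k ≢ j
  ◃⇒≢ j◃k refl = ◃.<-irrefl j◃k

  -- Let `j` be a code of a, padded until it comes after the first place `k` where a and b differ.
  -- Then e_j = a + ε_j exceeds a only from place `j` on, so it stays below b at `k`.
  dense₀ : ∀ {a b} → a <₀ b → ∃ λ j → a <₀ single j × single j <₀ b
  dense₀ {a} {b} (lex₀ (k , ak<bk , a≡b)) = j ,
    lex₀ (j , subst (coords₀ a j <_) (sym at-j) (x<1+x _) , sym ∘ before) ,
    lex₀ (k , subst (_< coords₀ b k) (sym (before k≺j)) ak<bk ,
          λ i≺k → trans (before (≺-trans i≺k k≺j)) (a≡b i≺k))
    where
    t j : Tree
    t = code (terms a)
    j = pad (suc (size k)) t

    k≺j : k ≺ j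
    k≺j = smaller (subst (size k ℕ.<_) (sym (size-pad (suc (size k)) t)) (ℕ.m≤m+n _ (size t)))

    coords-j : ∀ i → coords₀ (single j) i ≡ δ i j + coords₀ a i
    coords-j i = trans (ext-single (ε i) j)
      (cong (δ i j +_) (trans (decode-pad i (suc (size k)) t) (decode-code i (terms a))))

    at-j : coords₀ (single j) j ≡ 1# + coords₀ a j
    at-j = trans (coords-j j) (cong (_+ coords₀ a j) (δ-refl j))

    before : ∀ {i} → i ≺ j → coords₀ (single j) i ≡ coords₀ a i
    before {i} i≺j = trans (coords-j i)
      (trans (cong (_+ coords₀ a i) (δ-≢ {i} λ { refl → ≺-irrefl i≺j })) (+-identityˡ _))

  -- Independence of the two orders.

  module Endpoints {_⋖_ : Free → Free → Set} (⋖-⊕ : ∀ {x y} z → x ⋖ y → (x ⊕ z) ⋖ (y ⊕ z))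
                   {p : Free} (0⋖p : 𝟘 ⋖ p) where

    above : ∀ x → x ⋖ (p ⊕ x)
    above x = subst (_⋖ (p ⊕ x)) (⊕-identityˡ x) (⋖-⊕ x 0⋖p)

    below : ∀ x → (x ⊕ (⊖ p)) ⋖ x
    below x = subst ((x ⊕ (⊖ p)) ⋖_)
      (trans (⊕-comm p (x ⊕ (⊖ p))) (//-rightDividesˡ p x)) (above (x ⊕ (⊖ p)))

    -- An infinite endpoint is replaced by the other one moved by the positive vector `p`, which
    -- shrinks the interval to a bounded one.
    finite-endpoints : ∀ lo hi → LoHi _⋖_ lo hi → ∃ λ a → ∃ λ b → a ⋖ b ×
      (∀ {z} → a ⋖ z → z ⋖ b → AboveLo _⋖_ lo z × BelowHi _⋖_ z hi)
    finite-endpoints (just a) (just b) a⋖b = a , b , a⋖b , _,_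
    finite-endpoints (just a) nothing  _   = a , p ⊕ a , above a , λ a⋖z _ → a⋖z , _
    finite-endpoints nothing  (just b) _   = b ⊕ (⊖ p) , b , below b , λ _ z⋖b → _ , z⋖b
    finite-endpoints nothing  nothing  _   = 𝟘 , p , 0⋖p , λ _ _ → _ , _

  0<₀single-leaf : 𝟘 <₀ single leaf
  0<₀single-leaf = lex₀ (leaf ,
    subst (0# <_) (sym (trans (ext-single (ε leaf) leaf) (ε-diagonal leaf))) 0<1 ,
    λ i≺leaf → contradiction i≺leaf ⊀leaf)

  0<₁single : ∀ k → 𝟘 <₁ single k
  0<₁single k = lex₁ (k , subst (0# <_) (sym (coef-single-refl k)) 0<1 ,
    λ i◃k → sym (coef-single-≢ (◃⇒≢ i◃k)))

  module Endpoints₀ = Endpoints {_<₀_} <₀-⊕ {single leaf} 0<₀single-leaf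
  module Endpoints₁ = Endpoints {_<₁_} <₁-⊕ {single leaf} (0<₁single leaf)

  single-between : ∀ {a a' b} → a <₀ b → a' <₀ b → ∃ λ j → a <₀ single j × a' <₀ single j × single j <₀ b
  single-between {a} {a'} a<b a'<b with <₀.<-connex a a'
  ... | inj₁ a<a'        = let j , a'<j , j<b = dense₀ a'<b in j , <₀.<-trans a<a' a'<j , a'<j , j<b
  ... | inj₂ (inj₁ refl) = let j , a<j , j<b = dense₀ a<b in j , a<j , a<j , j<b
  ... | inj₂ (inj₂ a'<a) = let j , a<j , j<b = dense₀ a<b in j , a<j , <₀.<-trans a'<a a<j , j<b

  upper-bound : ∀ a a' → ∃ λ b → a <₀ b × a' <₀ b
  upper-bound a a' with <₀.<-connex a a'
  ... | inj₁ a<a'        = _ , <₀.<-trans a<a' (Endpoints₀.above a') , Endpoints₀.above a'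
  ... | inj₂ (inj₁ refl) = _ , Endpoints₀.above a , Endpoints₀.above a
  ... | inj₂ (inj₂ a'<a) = _ , Endpoints₀.above a , <₀.<-trans a'<a (Endpoints₀.above a)

  -- Intervals of the two orders meet in a point of the form c + e_j - e_i.  If
  -- e_i and e_j are <₀-large, they are infinitesimal for <₁, while their
  -- difference can be steered into any <₀-interval.
  shift : Free → Tree → Tree → Free
  shift c i j = single j ⊕ (⊖ (single i ⊕ (⊖ c)))

  -- With s = e_i - c, the shift lies between a and b exactly when e_j lies between a + s and b + s.
  -- A large e_i pushes b + s above e_q, which leaves room for an e_j that is also above e_q.
  shift-between : ∀ {a b} c q → a <₀ b → ∃ λ i → ∃ λ j →
                  (q ◃ i × q ◃ j) × (a <₀ shift c i j × shift c i j <₀ b)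
  shift-between {a} {b} c q a<b =
    let _ , q<u , m<u          = upper-bound (single q) m
        i , q◃i , m<i , _      = single-between q<u m<u
        j , q◃j , a+s<j , j<b+s = single-between (q<b+s m<i) (<₀-⊕ (s i) a<b)
    in i , j , (q◃i , q◃j) ,
       subst (_<₀ shift c i j) (//-rightDividesʳ (s i) a) (<₀-⊕ (⊖ s i) a+s<j) ,
       subst (shift c i j <₀_) (//-rightDividesʳ (s i) b) (<₀-⊕ (⊖ s i) j<b+s)
    where
    m : Free
    -- Solves e_q < b + (e_i - c) for e_i.
    m = (single q ⊕ (⊖ b)) ⊕ c

    s : Tree → Free
    s i = single i ⊕ (⊖ c)

    q<b+s : ∀ {i} → m <₀ single i → single q <₀ (b ⊕ s i)
    q<b+s {i} m<i = subst₂ _<₀_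
      (trans (cong (_⊕ b) (//-rightDividesʳ c (single q ⊕ (⊖ b)))) (//-rightDividesˡ b (single q)))
      (⊕-comm (s i) b) (<₀-⊕ b (<₀-⊕ (⊖ c) m<i))

  coef-shift : ∀ c {i j l} → i ≢ l → j ≢ l → coef (shift c i j) l ≡ coef c l
  coef-shift c {i} {j} {l} i≢l j≢l = begin
    coef (shift c i j) l                  ≡⟨ coef-⊕ (single j) (⊖ s) l ⟩
    coef (single j) l + coef (⊖ s) l      ≡⟨ cong₂ _+_ (coef-single-≢ j≢l) (coef-⊖ s l) ⟩
    0# + - coef s l                       ≡⟨ +-identityˡ _ ⟩
    - coef s l                            ≡⟨ cong -_ (coef-⊕ (single i) (⊖ c) l) ⟩
    - (coef (single i) l + coef (⊖ c) l)  ≡⟨ cong -_ (cong₂ _+_ (coef-single-≢ i≢l) (coef-⊖ c l)) ⟩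
    - (0# + - coef c l)                   ≡⟨ cong -_ (+-identityˡ _) ⟩
    - - coef c l                          ≡⟨ ⁻¹-involutive _ ⟩
    coef c l                              ∎
    where
    open ≡-Reasoning
    s : Free
    s = single i ⊕ (⊖ c)

  -- The endpoints a₁ and b₁ first differ at `k`. For any `q` beyond `k`, a₁ + e_q lies between them
  -- for `<₁`, and a correction e_j - e_i with both indices beyond `q` keeps it there.
  intervals-meet : ∀ {a₀ b₀ a₁ b₁} → a₀ <₀ b₀ → a₁ <₁ b₁ →
                   ∃ λ z → (a₀ <₀ z × z <₀ b₀) × (a₁ <₁ z × z <₁ b₁)
  intervals-meet {a₀} {b₀} {a₁} {b₁} a₀<b₀ (lex₁ (k , a₁k<b₁k , a₁≡b₁)) =
    let q , k◃q , _                     = dense₀ (Endpoints₀.above (single k))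
        i , j , (q◃i , q◃j) , a₀<z , z<b₀ = shift-between (a₁ ⊕ single q) q a₀<b₀
    in shift (a₁ ⊕ single q) i j , (a₀<z , z<b₀) , infinitesimally-above k◃q q◃i q◃j
    where
    infinitesimally-above : ∀ {q i j} → k ◃ q → q ◃ i → q ◃ j →
      a₁ <₁ shift (a₁ ⊕ single q) i j × shift (a₁ ⊕ single q) i j <₁ b₁
    infinitesimally-above {q} {i} {j} k◃q q◃i q◃j =
      lex₁ (q , subst (coef a₁ q <_) (sym at-q) (x<1+x _) , sym ∘ before-q) ,
      lex₁ (k , subst (_< coef b₁ k) (sym (before-q k◃q)) a₁k<b₁k ,
            λ l◃k → trans (before-q (◃.<-trans l◃k k◃q)) (a₁≡b₁ l◃k))
      where
      z : Free
      z = shift (a₁ ⊕ single q) i j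

      at-q : coef z q ≡ 1# + coef a₁ q
      at-q = trans (coef-shift (a₁ ⊕ single q) (◃⇒≢ q◃i) (◃⇒≢ q◃j)) (trans (coef-⊕ a₁ (single q) q)
        (trans (cong (coef a₁ q +_) (coef-single-refl q)) (+-comm _ _)))

      before-q : ∀ {l} → l ◃ q → coef z l ≡ coef a₁ l
      before-q {l} l◃q = trans
        (coef-shift (a₁ ⊕ single q) (◃⇒≢ (◃.<-trans l◃q q◃i)) (◃⇒≢ (◃.<-trans l◃q q◃j)))
        (trans (coef-⊕ a₁ (single q) l)
          (trans (cong (coef a₁ l +_) (coef-single-≢ (◃⇒≢ l◃q))) (+-identityʳ _)))

  -- Leading terms and the valuation.

  IsLead : Free → Tree → Set
  IsLead x k = coef x k ≢ 0# × (∀ {i} → i ◃ k → coef x i ≡ 0#)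

  lead? : ∀ x → x ≡ 𝟘 ⊎ ∃ (IsLead x)
  lead? x with Lexicographic.first-difference-supported C ◃-sto (coef x) (const 0#) (keys x) (coef-∉ x)
  ... | inj₁ x≡0 = inj₁ (coef-injective x≡0)
  ... | inj₂ k   = inj₂ k

  lead-unique : ∀ {x k l} → IsLead x k → IsLead x l → k ≡ l
  lead-unique {k = k} {l} (xk≢0 , x≡0) (xl≢0 , x≡0') with ◃-connex k l
  ... | inj₁ k◃l        = contradiction (x≡0' k◃l) xk≢0
  ... | inj₂ (inj₁ k≡l) = k≡l
  ... | inj₂ (inj₂ l◃k) = contradiction (x≡0 l◃k) xl≢0

  single-lead : ∀ k → IsLead (single k) k
  single-lead k = (λ e → 0≢1 (trans (sym e) (coef-single-refl k))) ,
                  λ i◃k → coef-single-≢ (◃⇒≢ i◃k)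

  v : Free → Maybe Free
  v x with lead? x
  ... | inj₁ _       = nothing
  ... | inj₂ (k , _) = just (single k)

  -- Pairs each value of `v` with its reason, so that later proofs can rewrite by an equation.
  v-view : ∀ x → (x ≡ 𝟘 × v x ≡ nothing) ⊎ (∃ λ k → IsLead x k × v x ≡ just (single k))
  v-view x with lead? x
  ... | inj₁ x≡0      = inj₁ (x≡0 , refl)
  ... | inj₂ (k , xk) = inj₂ (k , xk , refl)

  v-𝟘 : v 𝟘 ≡ nothing
  v-𝟘 with v-view 𝟘
  ... | inj₁ (_ , e)            = e
  ... | inj₂ (_ , (0≢0 , _) , _) = contradiction refl 0≢0

  v-lead : ∀ {x k} → IsLead x k → v x ≡ just (single k)
  v-lead {x} xk with v-view x
  ... | inj₁ (refl , _)   = contradiction refl (proj₁ xk)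
  ... | inj₂ (l , xl , e) = trans e (cong (just ∘ single) (lead-unique {x} xl xk))

  v-single : ∀ k → v (single k) ≡ just (single k)
  v-single k = v-lead (single-lead k)

  -- The leading index comes no later than any index with non-zero coefficient.
  v≤ : ∀ {x k l} → coef x k ≢ 0# → k ◃ l ⊎ k ≡ l → Le∞ _<₀_ (v x) (just (single l))
  v≤ {x} {k} {l} xk≢0 k≤l with v-view x
  ... | inj₁ (refl , _) = contradiction refl xk≢0
  ... | inj₂ (j , (_ , before) , e) rewrite e with ◃-connex j k | k≤l
  ...   | inj₁ j◃k         | inj₁ k◃l  = inj₁ (<₀.<-trans j◃k k◃l)
  ...   | inj₁ j◃k         | inj₂ refl = inj₁ j◃k
  ...   | inj₂ (inj₁ refl) | inj₁ k◃l  = inj₁ k◃l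
  ...   | inj₂ (inj₁ refl) | inj₂ refl = inj₂ refl
  ...   | inj₂ (inj₂ k◃j)  | _         = contradiction (before k◃j) xk≢0

  ≤nothing : ∀ u → Le∞ _<₀_ u nothing
  ≤nothing (just _) = inj₁ _
  ≤nothing nothing  = inj₂ refl

  v-∞ : ∀ x → (v x ≡ nothing → x ≡ 𝟘) × (x ≡ 𝟘 → v x ≡ nothing)
  v-∞ x = to , λ { refl → v-𝟘 }
    where
    to : v x ≡ nothing → x ≡ 𝟘
    to vx≡∞ with v-view x
    ... | inj₁ (x≡0 , _)   = x≡0
    ... | inj₂ (_ , _ , e) with trans (sym e) vx≡∞
    ...   | ()

  -- At the leading index of the sum, x and y cannot both have coefficient 0.
  v-ultra : ∀ x y → Le∞ _<₀_ (v x) (v (x ⊕ y)) ⊎ Le∞ _<₀_ (v y) (v (x ⊕ y))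
  v-ultra x y with v-view (x ⊕ y)
  ... | inj₁ (_ , e) rewrite e = inj₁ (≤nothing (v x))
  ... | inj₂ (k , (xyk≢0 , _) , e) rewrite e with coef x k ≟ 0#
  ...   | no  xk≢0 = inj₁ (v≤ {x} xk≢0 (inj₂ refl))
  ...   | yes xk≡0 = inj₂ (v≤ {y} (λ yk≡0 → xyk≢0
    (trans (coef-⊕ x y k) (trans (cong₂ _+_ xk≡0 yk≡0) (+-identityˡ 0#)))) (inj₂ refl))

  v-scal : ∀ a x → a ≢ 0# → v (a ⊙ x) ≡ v x
  v-scal a x a≢0 with lead? x
  ... | inj₁ refl                = cong v (coef-injective {a ⊙ 𝟘} {𝟘} λ i → trans (coef-⊙ a 𝟘 i) (zeroʳ a))
  ... | inj₂ (k , xk≢0 , before) = v-lead {a ⊙ x}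
    ( (λ axk≡0 → xk≢0 (xy≡0⇒y≡0 a≢0 (trans (sym (coef-⊙ a x k)) axk≡0)))
    , λ {i} i◃k → trans (coef-⊙ a x i) (trans (cong (a *_) (before i◃k)) (zeroʳ a)) )

  0<⇒≢0 : ∀ {c} → 0# < c → c ≢ 0#
  0<⇒≢0 0<c refl = <-irrefl 0<c

  -- Here `k` is the leading index of x and `l` the first difference of x and y. The earlier of the
  -- two carries a non-zero coefficient of y.
  v-anti : ∀ x y → 𝟘 <₁ x → x <₁ y → Le∞ _<₀_ (v y) (v x)
  v-anti x y (lex₁ (k , 0<xk , 0≡x)) (lex₁ (l , xl<yl , x≡y))
    rewrite v-lead {x} (0<⇒≢0 0<xk , sym ∘ 0≡x) with ◃-connex l k
  ... | inj₁ l◃k         = v≤ {y} (0<⇒≢0 (subst (_< coef y l) (sym (0≡x l◃k)) xl<yl)) (inj₁ l◃k)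
  ... | inj₂ (inj₁ refl) = v≤ {y} (0<⇒≢0 (<-trans 0<xk xl<yl)) (inj₂ refl)
  ... | inj₂ (inj₂ k◃l)  = v≤ {y} (0<⇒≢0 (subst (0# <_) (x≡y k◃l) 0<xk)) (inj₂ refl)

  v-idem : ∀ x g → v x ≡ just g → v g ≡ just g
  v-idem x g vx≡g with v-view x
  ... | inj₁ (_ , e)     with trans (sym e) vx≡g
  ...   | ()
  v-idem x g vx≡g | inj₂ (k , _ , e) with trans (sym e) vx≡g
  ...   | refl = v-single k

  v-pos : ∀ x → Lt∞ _<₁_ (just 𝟘) (v x)
  v-pos x with lead? x
  ... | inj₁ _       = _
  ... | inj₂ (k , _) = 0<₁single k

  independent : ∀ a₀ b₀ a₁ b₁ → LoHi _<₀_ a₀ b₀ → LoHi _<₁_ a₁ b₁ →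
                ∃ λ z → (AboveLo _<₀_ a₀ z × BelowHi _<₀_ z b₀) × (AboveLo _<₁_ a₁ z × BelowHi _<₁_ z b₁)
  independent a₀ b₀ a₁ b₁ a₀<b₀ a₁<b₁ =
    let _ , _ , c₀<d₀ , inside₀ = Endpoints₀.finite-endpoints a₀ b₀ a₀<b₀
        _ , _ , c₁<d₁ , inside₁ = Endpoints₁.finite-endpoints a₁ b₁ a₁<b₁
        z , (c₀<z , z<d₀) , (c₁<z , z<d₁) = intervals-meet c₀<d₀ c₁<d₁
    in z , inside₀ c₀<z z<d₀ , inside₁ c₁<z z<d₁

  v-dense : ∀ a b → a <₀ b → ∃ λ c → Lt∞ _<₀_ (just a) (v c) × Lt∞ _<₀_ (v c) (just b)
  v-dense a b a<b = let j , a<j , j<b = dense₀ a<b in single j ,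
    subst (Lt∞ _<₀_ (just a)) (sym (v-single j)) a<j ,
    subst (λ u → Lt∞ _<₀_ u (just b)) (sym (v-single j)) j<b

  model : HamelSpace C
  model = record
    { Carrier = Free ; _+_ = _⊕_ ; -_ = ⊖_ ; 0# = 𝟘 ; _·_ = _⊙_ ; _<₀_ = _<₀_ ; _<₁_ = _<₁_ ; v = v
    ; isAbelianGroup = ⊕-isAbelianGroup
    ; ·-assoc = ⊙-assoc ; ·-unit = ⊙-unit ; ·-distˡ = ⊙-distribˡ ; ·-distʳ = ⊙-distribʳ
    ; <₀-sto = <₀-sto ; <₁-sto = <₁-sto ; <₀-+ = <₀-⊕ ; <₁-+ = <₁-⊕ ; <₀-· = <₀-⊙ ; <₁-· = <₁-⊙
    ; v-∞ = v-∞ ; v-ultra = v-ultra ; v-scal = v-scal ; v-anti = v-anti ; v-idem = v-idem ; v-pos = v-pos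
    ; independent = independent ; dense = v-dense
    }

-- The pattern of infinite depth in one variable.

module Pattern (C : OrderedField) where
  open OrderedFieldProperties C
  open Trees C
  open HamelModel C
  open Semantics model

  fromℕ : ℕ → A
  fromℕ zero    = 0#
  fromℕ (suc n) = 1# + fromℕ n

  -- e_{index n j} is infinitely close to n e_leaf for <₀.
  index : ℕ → ℕ → Tree
  index n j = pad j (node (fromℕ n) leaf leaf)

  -- The padding shows in the size, which is `j + 1`.
  index-injective : ∀ {n i j} → index n i ≡ index n j → i ≡ j
  index-injective {n} {i} {j} e = ℕ.+-cancelʳ-≡ 1 i j
    (trans (sym (size-pad i t)) (trans (cong size e) (size-pad j t)))
    where
    t : Tree
    t = node (fromℕ n) leaf leaf

  index-leaf : ∀ n j → coords₀ (single (index n j)) leaf ≡ fromℕ n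
  index-leaf n j = begin
    coords₀ (single (index n j)) leaf             ≡⟨ ext-single (ε leaf) (index n j) ⟩
    δ leaf (index n j) + decode leaf (index n j)  ≡⟨ cong₂ _+_ (δ-≢ {leaf} (index≢leaf j))
                                                              (decode-pad leaf j _) ⟩
    0# + (fromℕ n * ε leaf leaf + 0#)             ≡⟨ +-identityˡ _ ⟩
    fromℕ n * ε leaf leaf + 0#                    ≡⟨ +-identityʳ _ ⟩
    fromℕ n * ε leaf leaf                         ≡⟨ cong (fromℕ n *_) (ε-diagonal leaf) ⟩
    fromℕ n * 1#                                  ≡⟨ *-identityʳ _ ⟩
    fromℕ n                                       ∎
    where
    open ≡-Reasoning
    index≢leaf : ∀ j → index n j ≢ leaf
    index≢leaf zero    ()
    index≢leaf (suc _) ()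

  -- The least tree `leaf` gives the most significant coordinate for `<₀`, and there the two vectors
  -- have the values n and n + 1, whatever the padding.
  index-◃ : ∀ n i j → index n i ◃ index (suc n) j
  index-◃ n i j = lex₀ (leaf ,
    subst₂ _<_ (sym (index-leaf n i)) (sym (index-leaf (suc n) j)) (x<1+x (fromℕ n)) ,
    λ k≺leaf → contradiction k≺leaf ⊀leaf)

  -- The signature has no subtraction, so x - v(x) is written with the scalar -1.
  residue : ℕ → Term A 2
  residue zero    = var Fin.zero
  residue (suc n) = residue n `+ `λ (- 1#) (`v (residue n))

  -- An equation with a function of x: among distinct parameters at most one can satisfy it, so the
  -- negated instances follow from the positive one.
  φ : ℕ → Formula A 2
  φ n = `v (residue n) `≡ var (Fin.suc Fin.zero)

  parameter : ℕ → ℕ → Fin 1 → U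
  parameter n j _ = just (single (index n j))

  module Realisation (η : ℕ → ℕ) where
    branch : ℕ → Tree
    branch n = index n (η n)

    branch-◃ : ∀ n → branch n ◃ branch (suc n)
    branch-◃ n = index-◃ n (η n) (η (suc n))

    -- Indexed by start and length, so that peeling off the leading vector gives a segment again.
    segment : ℕ → ℕ → Free
    segment n zero    = 𝟘
    segment n (suc m) = single (branch n) ⊕ segment (suc n) m

    segment-vanish : ∀ n m {i} → i ◃ branch n → coef (segment n m) i ≡ 0#
    segment-vanish n zero    _   = refl
    segment-vanish n (suc m) {i} i◃n = trans (coef-⊕ (single (branch n)) (segment (suc n) m) i)
      (trans (cong₂ _+_ (coef-single-≢ (◃⇒≢ i◃n))
                        (segment-vanish (suc n) m (IsStrictTotalOrder.trans ◃-sto i◃n (branch-◃ n))))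
             (+-identityˡ 0#))

    segment-lead : ∀ n m → IsLead (segment n (suc m)) (branch n)
    segment-lead n m = (λ e → 0≢1 (trans (sym e) at-n)) , segment-vanish n (suc m)
      where
      at-n : coef (segment n (suc m)) (branch n) ≡ 1#
      at-n = trans (coef-⊕ (single (branch n)) (segment (suc n) m) (branch n))
        (trans (cong₂ _+_ (coef-single-refl (branch n)) (segment-vanish (suc n) m (branch-◃ n)))
               (+-identityʳ 1#))

    segment-tail : ∀ n m → segment n (suc m) ⊕ (⊖ single (branch n)) ≡ segment (suc n) m
    segment-tail n m = trans
      (cong (_⊕ (⊖ single (branch n))) (⊕-comm (single (branch n)) (segment (suc n) m)))
      (//-rightDividesʳ (single (branch n)) (segment (suc n) m))

    -- After n peelings the terms from n on remain, and `branch n` leads them. The `suc m`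
    -- guarantees that a term is left; otherwise the value would be ∞.
    eval-v-residue : ∀ {N} ρ → ρ Fin.zero ≡ just (segment 0 N) → ∀ n m → n ℕ.+ suc m ≡ N →
                     v∞ (eval (residue n) ρ) ≡ just (single (branch n))
    eval-residue : ∀ {N} ρ → ρ Fin.zero ≡ just (segment 0 N) → ∀ n m → n ℕ.+ m ≡ N →
                   eval (residue n) ρ ≡ just (segment n m)

    eval-v-residue ρ ρ₀ n m e = trans (cong v∞ (eval-residue ρ ρ₀ n (suc m) e)) (v-lead (segment-lead n m))

    eval-residue ρ ρ₀ zero    m refl = ρ₀
    eval-residue ρ ρ₀ (suc n) m e    = trans
      (cong₂ (λ s t → add∞ s (scal∞ (- 1#) t))
             (eval-residue ρ ρ₀ n (suc m) e') (eval-v-residue ρ ρ₀ n m e'))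
      (cong just (segment-tail n m))
      where
      e' = trans (ℕ.+-suc n m) e

  pattern-φ : ωPattern model 1 (const 1) φ parameter
  -- The realisation is the sum of the first N chosen basis vectors.
  pattern-φ η N J = const (just (segment 0 N)) , λ n n<N →
    let m , 1+n+m≡N = ℕ.m≤n⇒∃[o]m+o≡n n<N
        v≡ = λ ρ ρ₀ → eval-v-residue {N} ρ ρ₀ n m (trans (ℕ.+-suc n m) 1+n+m≡N)
    in v≡ _ refl ,
       -- A second solution `j` would give the same basis vector, hence the same index.
       λ j _ j≢ηn v≡j → j≢ηn (index-injective {n}
         (single-injective (just-injective (trans (sym v≡j) (v≡ _ refl)))))
    where open Realisation η

  -- The first d rows of the infinite pattern, which already uses a single variable, form a pattern
  -- of depth d.
  ict-φ : ∀ d → ictPattern model d (const 1) (φ ∘ Fin.toℕ) (parameter ∘ Fin.toℕ)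
  ict-φ d η J = let a , realises = pattern-φ η̂ d J in a , λ α →
    subst (λ n → SatXY (φ (Fin.toℕ α)) a (parameter (Fin.toℕ α) n) ×
                 (∀ j → j ℕ.< J → j ≢ n → ¬ SatXY (φ (Fin.toℕ α)) a (parameter (Fin.toℕ α) j)))
          (η̂-toℕ α) (realises (Fin.toℕ α) (FinP.toℕ<n α))
    where
    -- Extends the finite choice by 0; the realisation of depth d only consults rows below d.
    η̂ : ℕ → ℕ
    η̂ n with n ℕ.<? d
    ... | yes n<d = η (Fin.fromℕ< n<d)
    ... | no  _   = 0

    η̂-toℕ : ∀ α → η̂ (Fin.toℕ α) ≡ η α
    η̂-toℕ α with Fin.toℕ α ℕ.<? d
    ... | yes α<d = cong η (FinP.fromℕ<-toℕ α α<d)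
    ... | no  α≮d = contradiction (FinP.toℕ<n α) α≮d

  ¬dpRank< : ∀ d → ¬ dpRank< C d
  ¬dpRank< d rank = rank model (const 1) (φ ∘ Fin.toℕ) (parameter ∘ Fin.toℕ) (ict-φ d)

theorem7p1 : (C : OrderedField) →
    ¬ StronglyDependent C × ¬ DpMinimal C × ¬ FiniteDpRank C
theorem7p1 C =
  (λ dependent → dependent model 1 (const 1) φ parameter pattern-φ) ,
  ¬dpRank< 2 ,
  λ (d , rank) → ¬dpRank< d rank
  where
  open HamelModel C using (model)
  open Pattern C
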